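{- Let $\mathcal K$ be an abstract Krivine structure and $\mathcal A_{\mathcal K\bullet}=(\mathcal P_\bullet(\Pi),\circ_\bullet,\to_\bullet,\supseteq,\mathsf k_\bullet,\mathsf s_\bullet,\Phi)$ the associated full adjunction implicative ordered combinatory algebra. Then the indexed preorders $\mathbf P_\bullet(\mathcal K)$ and $\mathbf P(\mathcal A_{\mathcal K\bullet})$ are isomorphic; namely, for every set $I$ and all $\varphi,\psi:I\to\mathcal P_\bullet(\Pi)$: there is $t\in\mathrm{QP}$ with $t\perp\varphi(i)\to_\bullet\psi(i)$ for all $i\in I$ if and only if there is $r\in\Phi$ with $r\circ_\bullet\varphi(i)\supseteq\psi(i)$ for all $i\in I$.
   Context: An abstract Krivine structure $\mathcal K$ consists of sets $\Lambda,\Pi$, a relation $\perp\subseteq\Lambda\times\Pi$ ($t\perp P$ means $t\perp\pi$ for all $\pi\in P$), a map $\mathrm{push}$ written $t\cdot\pi$ (associating to the right), an application $ts$ on $\Lambda$ (associating to the left), a subset $\mathrm{QP}\subseteq\Lambda$ closed under application, and $\mathsf K,\mathsf S\in\mathrm{QP}$ with: $t\perp s\cdot\pi\Rightarrow ts\perp\pi$; $t\perp\pi\Rightarrow\mathsf K\perp t\cdot s\cdot\pi$; $tu(su)\perp\pi\Rightarrow\mathsf S\perp t\cdot s\cdot u\cdot\pi$. Polars: $L^\perp=\{\pi:\forall t\in L,\ t\perp\pi\}$, ${}^\perp P=\{t:\forall\pi\in P,\ t\perp\pi\}$; $\overline P=({}^\perp P)^\perp$; $\widehat P=\bigcup_{\pi\in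 P}\overline{\{\pi\}}$; $\mathcal P_\bullet(\Pi)=\{P:\widehat P=P\}$. $P\to_\bullet Q=\widehat{\{t\cdot\pi:t\in{}^\perp P,\pi\in Q\}}$; $P\circ_\bullet Q=\{\pi:t\cdot\pi'\in P\ \forall t\in{}^\perp Q,\ \pi'\in\overline{\{\pi\}}\}$; $\mathsf E=\mathsf S(\mathsf K(\mathsf S\mathsf K\mathsf K))$, $\mathsf B=\mathsf S(\mathsf K\mathsf S)\mathsf K$, $\mathsf k_\bullet=\{\mathsf E\mathsf K\}^\perp$, $\mathsf s_\bullet=\{\mathsf E((\mathsf B\mathsf E)\mathsf S)\}^\perp$, $\Phi=\{P\in\mathcal P_\bullet(\Pi):\exists t\in\mathrm{QP},\ t\perp P\}$. $\mathbf P_\bullet(\mathcal K)$ is the functor $\mathbf{Set}^{op}\to\mathbf{Ord}$, $I\mapsto(\mathcal P_\bullet(\Pi)^I,\vdash)$ with $\varphi\vdash\psi$ iff $\exists t\in\mathrm{QP}\ \forall i,\ t\perp\varphi(i)\to_\bullet\psi(i)$, and $f\mapsto(\varphi\mapsto\varphi\circ f)$. For an ordered combinatory algebra $\mathcal A$ with carrier $A$, order $\le$ and filter $\Phi$, $\mathbf P(\mathcal A)$ is $I\mapsto(A^I,\vdash)$ with $\varphi\vdash\psi$ iff $\exists r\in\Phi\ \forall i,\ r\varphi(i)\le\psi(i)$, and $f\mapsto(\varphi\mapsto\varphi\circ f)$; for $\mathcal A_{\mathcal K\bullet}$, $\le$ is $\supseteq$ and application is $\circ_\bullet$. -}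

module Defs where

open import Level using (Level; _⊔_) renaming (suc to lsuc)
open import Data.Product using (_×_; _,_; proj₁; proj₂; ∃-syntax)
open import Function using (_∘_; id)
open import Relation.Binary.Bundles using (Preorder)
open import Relation.Binary.Core using (Rel)
open import Relation.Binary.Structures using (IsPartialOrder)
open import Relation.Binary.Morphism.Bundles using (PreorderHomomorphism)
open import Relation.Binary.PropositionalEquality using (_≡_; refl; cong; _≗_)
open import Relation.Unary using (Pred; _∈_; _⊆_; _⊇_; _≐_; ｛_｝)

-- A functor Setᵒᵖ → Ord.  Equality of morphisms is pointwise: equality of
-- functions in Set, the equality _≈_ of the target preorder in Ord.
record IndexedPreorder (i c e r : Level) : Set (lsuc (i ⊔ c ⊔ e ⊔ r)) where
  field
    fibre   : Set i → Preorder c e r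
    reindex : {I J : Set i} → (J → I) → PreorderHomomorphism (fibre I) (fibre J)

  module Fibre (I : Set i) = Preorder (fibre I)

  reindex⟦_⟧ : {I J : Set i} → (J → I) → Fibre.Carrier I → Fibre.Carrier J
  reindex⟦ f ⟧ = PreorderHomomorphism.⟦_⟧ (reindex f)

  field
    reindex-cong : {I J : Set i} {f g : J → I} → f ≗ g →
                   ∀ x → Fibre._≈_ J (reindex⟦ f ⟧ x) (reindex⟦ g ⟧ x)
    reindex-id   : {I : Set i} →
                   ∀ x → Fibre._≈_ I (reindex⟦ id ⟧ x) x
    reindex-∘    : {I J L : Set i} (f : J → I) (g : L → J) →
                   ∀ x → Fibre._≈_ L (reindex⟦ f ∘ g ⟧ x) (reindex⟦ g ⟧ (reindex⟦ f ⟧ x))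

infix 4 _≅_

-- Natural isomorphism.  Naturality of the inverse family is automatic.
record _≅_ {i c₁ e₁ r₁ c₂ e₂ r₂ : Level}
           (F : IndexedPreorder i c₁ e₁ r₁) (G : IndexedPreorder i c₂ e₂ r₂)
           : Set (lsuc i ⊔ c₁ ⊔ e₁ ⊔ r₁ ⊔ c₂ ⊔ e₂ ⊔ r₂) where
  private
    module F = IndexedPreorder F
    module G = IndexedPreorder G
  field
    to   : (I : Set i) → PreorderHomomorphism (F.fibre I) (G.fibre I)
    from : (I : Set i) → PreorderHomomorphism (G.fibre I) (F.fibre I)

  to⟦_⟧ : (I : Set i) → F.Fibre.Carrier I → G.Fibre.Carrier I
  to⟦ I ⟧ = PreorderHomomorphism.⟦_⟧ (to I)

  from⟦_⟧ : (I : Set i) → G.Fibre.Carrier I → F.Fibre.Carrier I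
  from⟦ I ⟧ = PreorderHomomorphism.⟦_⟧ (from I)

  field
    from∘to : (I : Set i) → ∀ x → F.Fibre._≈_ I (from⟦ I ⟧ (to⟦ I ⟧ x)) x
    to∘from : (I : Set i) → ∀ y → G.Fibre._≈_ I (to⟦ I ⟧ (from⟦ I ⟧ y)) y
    natural : {I J : Set i} (f : J → I) →
              ∀ x → G.Fibre._≈_ J (to⟦ J ⟧ (F.reindex⟦ f ⟧ x)) (G.reindex⟦ f ⟧ (to⟦ I ⟧ x))

-- An ordered combinatory algebra together with a filter Φ, that is, a subset
-- containing k and s and closed under application.
record OrderedCombinatoryAlgebra (c e r p : Level) : Set (lsuc (c ⊔ e ⊔ r ⊔ p)) where
  infix  4 _≈_ _≤_
  infixl 8 _∙_
  field
    Carrier        : Set c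
    _≈_            : Rel Carrier e
    _≤_            : Rel Carrier r
    isPartialOrder : IsPartialOrder _≈_ _≤_
    _∙_            : Carrier → Carrier → Carrier
    ∙-mono         : ∀ {a a′ b b′} → a ≤ a′ → b ≤ b′ → a ∙ b ≤ a′ ∙ b′
    k s            : Carrier
    k-law          : ∀ a b → k ∙ a ∙ b ≤ a
    s-law          : ∀ a b d → s ∙ a ∙ b ∙ d ≤ a ∙ d ∙ (b ∙ d)
    Φ              : Pred Carrier p
    k∈Φ            : k ∈ Φ
    s∈Φ            : s ∈ Φ
    Φ-closed       : ∀ {a b} → a ∈ Φ → b ∈ Φ → a ∙ b ∈ Φ

  open IsPartialOrder isPartialOrder public
    using () renaming (refl to ≤-refl; trans to ≤-trans; reflexive to ≤-reflexive;
                       isEquivalence to ≈-isEquivalence; module Eq to ≈-Eq)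

-- Full adjunction: ab ≤ d iff a ≤ b → d.  Infima are those of families
-- indexed by types in Set j: arbitrary subsets of the carrier would be
-- too large for a predicative power set to be complete.
record FullAdjunctionIOCA (c e r p j : Level) : Set (lsuc (c ⊔ e ⊔ r ⊔ p ⊔ j)) where
  infixr 5 _⇒_
  field
    oca : OrderedCombinatoryAlgebra c e r p

  open OrderedCombinatoryAlgebra oca public

  field
    _⇒_        : Carrier → Carrier → Carrier
    ⇒-mono     : ∀ {a a′ b b′} → a′ ≤ a → b ≤ b′ → a ⇒ b ≤ a′ ⇒ b′
    adjunction : ∀ {a b d} → (a ∙ b ≤ d → a ≤ b ⇒ d) × (a ≤ b ⇒ d → a ∙ b ≤ d)
    ⋀          : {J : Set j} → (J → Carrier) → Carrier
    ⋀-lower    : {J : Set j} (x : J → Carrier) → ∀ m → ⋀ x ≤ x m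
    ⋀-greatest : {J : Set j} (x : J → Carrier) → ∀ a → (∀ m → a ≤ x m) → a ≤ ⋀ x

module _ {c e r p : Level} (A : OrderedCombinatoryAlgebra c e r p) where
  open OrderedCombinatoryAlgebra A

  infix 4 _⊢ᴬ_

  _⊢ᴬ_ : {i : Level} {I : Set i} → Rel (I → Carrier) (c ⊔ r ⊔ p ⊔ i)
  φ ⊢ᴬ ψ = ∃[ a ] (a ∈ Φ × ∀ m → a ∙ φ m ≤ ψ m)

  private
    skk-law : ∀ a → s ∙ k ∙ k ∙ a ≤ a
    skk-law a = ≤-trans (s-law k k a) (k-law a (k ∙ a))

  𝐏 : (i : Level) → IndexedPreorder i (c ⊔ i) (e ⊔ i) (c ⊔ r ⊔ p ⊔ i)
  𝐏 i = record
    { fibre = λ I → record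
      { Carrier = I → Carrier
      ; _≈_     = λ φ ψ → ∀ m → φ m ≈ ψ m
      ; _≲_     = _⊢ᴬ_
      ; isPreorder = record
        { isEquivalence = record
          { refl  = λ m → ≈-Eq.refl
          ; sym   = λ φ≈ψ m → ≈-Eq.sym (φ≈ψ m)
          ; trans = λ φ≈ψ ψ≈θ m → ≈-Eq.trans (φ≈ψ m) (ψ≈θ m)
          }
        ; reflexive = λ φ≈ψ →
            s ∙ k ∙ k , Φ-closed (Φ-closed s∈Φ k∈Φ) k∈Φ ,
            λ m → ≤-trans (skk-law _) (≤-reflexive (φ≈ψ m))
        ; trans = λ { (a , a∈Φ , aφ≤ψ) (b , b∈Φ , bψ≤θ) →
            s ∙ (k ∙ b) ∙ a ,
            Φ-closed (Φ-closed s∈Φ (Φ-closed k∈Φ b∈Φ)) a∈Φ ,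
            λ m → ≤-trans (s-law _ _ _)
                    (≤-trans (∙-mono (k-law _ _) (aφ≤ψ m)) (bψ≤θ m)) }
        }
      }
    ; reindex = λ f → record
      { ⟦_⟧ = λ φ → φ ∘ f
      ; isOrderHomomorphism = record
        { cong = λ φ≈ψ m → φ≈ψ (f m)
        ; mono = λ { (a , a∈Φ , aφ≤ψ) → a , a∈Φ , λ m → aφ≤ψ (f m) }
        }
      }
    ; reindex-cong = λ f≗g φ m → ≈-Eq.reflexive (cong φ (f≗g m))
    ; reindex-id   = λ φ m → ≈-Eq.refl
    ; reindex-∘    = λ f g φ m → ≈-Eq.refl
    }
-- Λ, Π and all subsets live at a single level ℓ, which polars preserve.
record AbstractKrivineStructure (ℓ : Level) : Set (lsuc ℓ) where
  infix  4 _⊥_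
  infixr 7 _·_
  infixl 8 _∗_
  field
    Λ Π       : Set ℓ
    _⊥_       : Λ → Π → Set ℓ
    _·_       : Λ → Π → Π
    _∗_       : Λ → Λ → Λ
    QP        : Pred Λ ℓ
    QP-closed : ∀ {t s} → t ∈ QP → s ∈ QP → t ∗ s ∈ QP
    K S       : Λ
    K∈QP      : K ∈ QP
    S∈QP      : S ∈ QP
    ∗-law     : ∀ {t s π} → t ⊥ s · π → t ∗ s ⊥ π
    K-law     : ∀ {t s π} → t ⊥ π → K ⊥ t · s · π
    S-law     : ∀ {t s u π} → t ∗ u ∗ (s ∗ u) ⊥ π → S ⊥ t · s · u · π

module Krivine {ℓ : Level} (𝒦 : AbstractKrivineStructure ℓ) where
  open AbstractKrivineStructure 𝒦 public

  infix  4 _⫫_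
  infix  9 _^⊥ ⊥^_
  infixr 5 _⇒•_
  infixl 8 _∘•_

  _⫫_ : Λ → Pred Π ℓ → Set ℓ
  t ⫫ P = ∀ {π} → π ∈ P → t ⊥ π

  _^⊥ : Pred Λ ℓ → Pred Π ℓ
  (L ^⊥) π = ∀ {t} → t ∈ L → t ⊥ π

  ⊥^_ : Pred Π ℓ → Pred Λ ℓ
  (⊥^ P) t = t ⫫ P

  closure : Pred Π ℓ → Pred Π ℓ
  closure P = (⊥^ P) ^⊥

  hat : Pred Π ℓ → Pred Π ℓ
  hat P ρ = ∃[ π ] (π ∈ P × ρ ∈ closure ｛ π ｝)

  E B : Λ
  E = S ∗ (K ∗ (S ∗ K ∗ K))
  B = S ∗ (K ∗ S) ∗ K

  record 𝒫• : Set (lsuc ℓ) where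
    constructor _,_
    field
      ⌊_⌋    : Pred Π ℓ
      closed : hat ⌊_⌋ ≐ ⌊_⌋
  open 𝒫• public

  infix 4 _≈•_ _≤•_

  _≈•_ : Rel 𝒫• ℓ
  P ≈• Q = ⌊ P ⌋ ≐ ⌊ Q ⌋

  _≤•_ : Rel 𝒫• ℓ
  P ≤• Q = ⌊ P ⌋ ⊇ ⌊ Q ⌋

  private
    cl-refl : ∀ {π} → π ∈ closure ｛ π ｝
    cl-refl t⊥π = t⊥π refl

    -- ρ ∈ closure {π} means that every t ⊥ π satisfies t ⊥ ρ.
    transport : ∀ {t π ρ} → ρ ∈ closure ｛ π ｝ → t ⊥ π → t ⊥ ρ
    transport ρ∈ t⊥π = ρ∈ (λ { refl → t⊥π })

    cl-trans : ∀ {π ρ σ} → ρ ∈ closure ｛ π ｝ → σ ∈ closure ｛ ρ ｝ → σ ∈ closure ｛ π ｝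
    cl-trans ρ∈ σ∈ t⊥π = transport σ∈ (ρ∈ t⊥π)

    ⊆hat : ∀ {P} → P ⊆ hat P
    ⊆hat π∈P = _ , π∈P , cl-refl

    hat-idem : ∀ P → hat (hat P) ≐ hat P
    hat-idem P = (λ { (ρ , (π , π∈P , ρ∈) , σ∈) → π , π∈P , cl-trans ρ∈ σ∈ }) , ⊆hat

    down : (P : 𝒫•) → ∀ {π ρ} → π ∈ ⌊ P ⌋ → ρ ∈ closure ｛ π ｝ → ρ ∈ ⌊ P ⌋
    down P π∈P ρ∈ = proj₁ (closed P) (_ , π∈P , ρ∈)

    ⫫hat : ∀ {t P} → t ⫫ P → t ⫫ hat P
    ⫫hat t⫫P (π , π∈P , ρ∈) = transport ρ∈ (t⫫P π∈P)

  _⇒•_ : 𝒫• → 𝒫• → 𝒫•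
  P ⇒• Q = hat R , hat-idem R
    where
    R : Pred Π ℓ
    R ρ = ∃[ t ] ∃[ π ] (t ∈ ⊥^ ⌊ P ⌋ × π ∈ ⌊ Q ⌋ × ρ ≡ t · π)

  _∘•_ : 𝒫• → 𝒫• → 𝒫•
  P ∘• Q = R , (λ { (π , π∈R , ρ∈) t∈ π′∈ → π∈R t∈ (cl-trans ρ∈ π′∈) }) , ⊆hat
    where
    R : Pred Π ℓ
    R π = ∀ {t π′} → t ∈ ⊥^ ⌊ Q ⌋ → π′ ∈ closure ｛ π ｝ → t · π′ ∈ ⌊ P ⌋

  ｛_｝^⊥ : Λ → 𝒫•
  ｛ t ｝^⊥ = ｛ t ｝ ^⊥ , (λ { (π , π∈ , ρ∈) refl → transport ρ∈ (π∈ refl) }) , ⊆hat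

  k• s• : 𝒫•
  k• = ｛ E ∗ K ｝^⊥
  s• = ｛ E ∗ (B ∗ E ∗ S) ｝^⊥

  Φ : Pred 𝒫• ℓ
  Φ P = ∃[ t ] (t ∈ QP × t ⫫ ⌊ P ⌋)

  infix 4 _⊢•_

  _⊢•_ : {i : Level} {I : Set i} → Rel (I → 𝒫•) (ℓ ⊔ i)
  φ ⊢• ψ = ∃[ t ] (t ∈ QP × ∀ m → t ⫫ ⌊ φ m ⇒• ψ m ⌋)

  private
    I-law : ∀ {t π} → t ⊥ π → S ∗ K ∗ K ⊥ t · π
    I-law t⊥π = ∗-law (∗-law (S-law (∗-law (∗-law (K-law t⊥π)))))

    E-law : ∀ {t s π} → t ∗ s ⊥ π → E ⊥ t · s · π
    E-law ts⊥π = ∗-law (S-law (∗-law (∗-law (∗-law (K-law (I-law ts⊥π))))))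

    B-law : ∀ {t s u π} → t ⊥ s ∗ u · π → B ⊥ t · s · u · π
    B-law h =
      ∗-law (∗-law (S-law (∗-law (∗-law (∗-law (K-law (S-law (∗-law (∗-law (∗-law (K-law h)))))))))))

    I∈QP : S ∗ K ∗ K ∈ QP
    I∈QP = QP-closed (QP-closed S∈QP K∈QP) K∈QP

    E∈QP : E ∈ QP
    E∈QP = QP-closed S∈QP (QP-closed K∈QP I∈QP)

    B∈QP : B ∈ QP
    B∈QP = QP-closed (QP-closed S∈QP (QP-closed K∈QP S∈QP)) K∈QP

    principal∈Φ : ∀ {t} → t ∈ QP → ｛ t ｝^⊥ ∈ Φ
    principal∈Φ t∈QP = _ , t∈QP , λ π∈ → π∈ refl

    ⇒•-intro : ∀ P Q {t π} → t ∈ ⊥^ ⌊ P ⌋ → π ∈ ⌊ Q ⌋ → t · π ∈ ⌊ P ⇒• Q ⌋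
    ⇒•-intro P Q t∈ π∈ = ⊆hat (_ , _ , t∈ , π∈ , refl)

    ⫫⇒• : ∀ P Q {u} → (∀ {t π} → t ∈ ⊥^ ⌊ P ⌋ → π ∈ ⌊ Q ⌋ → u ⊥ t · π) → u ⫫ ⌊ P ⇒• Q ⌋
    ⫫⇒• P Q h = ⫫hat λ { (t , π , t∈ , π∈ , refl) → h t∈ π∈ }

    k•-law : ∀ P Q → k• ∘• P ∘• Q ≤• P
    k•-law P Q π∈P s∈ π′∈ t∈ ρ∈ refl =
      ∗-law (E-law (transport ρ∈ (∗-law (K-law (transport π′∈ (t∈ π∈P))))))

    s•-law : ∀ P Q R → s• ∘• P ∘• Q ∘• R ≤• P ∘• R ∘• (Q ∘• R)
    s•-law P Q R π∈ u∈ π₁∈ s∈ π₂∈ t∈ π₃∈ refl =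
      ∗-law (E-law (transport π₃∈ (∗-law (∗-law (∗-law (B-law (E-law
        (transport π₂∈ (∗-law (∗-law (S-law (transport π₁∈ (∗-law (∗-law
          (t∈ (π∈ (λ ρ∈ → ∗-law (s∈ (ρ∈ u∈ cl-refl))) cl-refl u∈ cl-refl))))))))))))))))

  𝒜• : FullAdjunctionIOCA (lsuc ℓ) ℓ ℓ ℓ ℓ
  𝒜• = record
    { oca = record
      { Carrier = 𝒫•
      ; _≈_     = _≈•_
      ; _≤_     = _≤•_
      ; isPartialOrder = record
        { isPreorder = record
          { isEquivalence = record
            { refl  = id , id
            ; sym   = λ { (p , q) → q , p }
            ; trans = λ { (p , q) (p′ , q′) → (λ x → p′ (p x)) , (λ x → q (q′ x)) }
            }
          ; reflexive = proj₂
          ; trans     = λ p q x → p (q x)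
          }
        ; antisym = λ p q → q , p
        }
      ; _∙_      = _∘•_
      ; ∙-mono   = λ p q π∈ t∈ π′∈ → p (π∈ (λ ρ∈ → t∈ (q ρ∈)) π′∈)
      ; k        = k•
      ; s        = s•
      ; k-law    = k•-law
      ; s-law    = s•-law
      ; Φ        = Φ
      ; k∈Φ      = principal∈Φ (QP-closed E∈QP K∈QP)
      ; s∈Φ      = principal∈Φ (QP-closed E∈QP (QP-closed (QP-closed B∈QP E∈QP) S∈QP))
      ; Φ-closed = λ { (t , t∈QP , t⫫P) (s , s∈QP , s⫫Q) →
          t ∗ s , QP-closed t∈QP s∈QP , λ π∈ → ∗-law (t⫫P (π∈ s⫫Q cl-refl)) }
      }
    ; _⇒_        = _⇒•_
    ; ⇒-mono     = λ { p q (_ , (t , π , t∈ , π∈ , refl) , ρ∈) →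
        _ , (t , π , (λ x → t∈ (p x)) , q π∈ , refl) , ρ∈ }
    ; adjunction = λ {P} {Q} {R} →
        (λ { h (_ , (t , π , t∈ , π∈ , refl) , ρ∈) → down P (h π∈ t∈ cl-refl) ρ∈ }) ,
        (λ h π∈ t∈ π′∈ → h (⇒•-intro Q R t∈ (down R π∈ π′∈)))
    ; ⋀          = λ x → (λ π → ∃[ m ] π ∈ ⌊ x m ⌋) ,
        (λ { (π , (m , π∈) , ρ∈) → m , down (x m) π∈ ρ∈ }) , ⊆hat
    ; ⋀-lower    = λ x m π∈ → m , π∈
    ; ⋀-greatest = λ { x a h (m , π∈) → h m π∈ }
    }

  𝐏• : (i : Level) → IndexedPreorder i (lsuc ℓ ⊔ i) (ℓ ⊔ i) (ℓ ⊔ i)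
  𝐏• i = record
    { fibre = λ I → record
      { Carrier = I → 𝒫•
      ; _≈_     = λ φ ψ → ∀ m → φ m ≈• ψ m
      ; _≲_     = _⊢•_
      ; isPreorder = record
        { isEquivalence = record
          { refl  = λ m → id , id
          ; sym   = λ φ≈ψ m → proj₂ (φ≈ψ m) , proj₁ (φ≈ψ m)
          ; trans = λ φ≈ψ ψ≈θ m →
              (λ x → proj₁ (ψ≈θ m) (proj₁ (φ≈ψ m) x)) ,
              (λ x → proj₂ (φ≈ψ m) (proj₂ (ψ≈θ m) x))
          }
        ; reflexive = λ {φ} {ψ} φ≈ψ → S ∗ K ∗ K , I∈QP , λ m →
            ⫫⇒• (φ m) (ψ m) (λ t∈ π∈ → I-law (t∈ (proj₂ (φ≈ψ m) π∈)))
        ; trans = λ { {φ} {ψ} {θ} (t , t∈QP , t⫫) (u , u∈QP , u⫫) →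
            B ∗ u ∗ t , QP-closed (QP-closed B∈QP u∈QP) t∈QP , λ m →
            ⫫⇒• (φ m) (θ m) (λ s∈ π∈ →
              ∗-law (∗-law (B-law (u⫫ m (⇒•-intro (ψ m) (θ m)
                (λ ρ∈ → ∗-law (t⫫ m (⇒•-intro (φ m) (ψ m) s∈ ρ∈))) π∈))))) }
        }
      }
    ; reindex = λ f → record
      { ⟦_⟧ = λ φ → φ ∘ f
      ; isOrderHomomorphism = record
        { cong = λ φ≈ψ m → φ≈ψ (f m)
        ; mono = λ { (t , t∈QP , t⫫) → t , t∈QP , λ m → t⫫ (f m) }
        }
      }
    ; reindex-cong = λ f≗g φ m → ≡⇒≈ φ (f≗g m)
    ; reindex-id   = λ φ m → id , id
    ; reindex-∘    = λ f g φ m → id , id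
    }
    where
    ≡⇒≈ : {I : Set i} (φ : I → 𝒫•) {m n : I} → m ≡ n → φ m ≈• φ n
    ≡⇒≈ φ refl = id , id

{-# OPTIONS --safe #-}

-- A quasi-proof t is orthogonal to P exactly when P ⊆ {t}^⊥, and {t}^⊥ is the
-- largest element of 𝒫• realised by t.  So a realiser t of φ ⇒• ψ and an r ∈ Φ
-- below φ ⇒• ψ determine each other, and the latter is, by the adjunction
-- between ∘• and ⇒•, the same as r ∘• φ ≤• ψ.

module Submission where

open import Level using (Level)
open import Data.Product using (_×_; _,_; proj₁; proj₂; ∃-syntax; Σ-syntax)
open import Function using (id)
open import Function.Bundles using (_⇔_; mk⇔)
open import Relation.Binary.PropositionalEquality using (_≡_; refl)
open import Relation.Unary using (_∈_; _⊇_)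
open import Defs

module _ {ℓ : Level} (𝒦 : AbstractKrivineStructure ℓ) where
  open Krivine 𝒦
  open FullAdjunctionIOCA 𝒜• using (oca; adjunction)

  module _ {i : Level} {I : Set i} (φ ψ : I → 𝒫•) where

    ⊢•⇒⊢ᴬ : φ ⊢• ψ → _⊢ᴬ_ oca φ ψ
    ⊢•⇒⊢ᴬ (t , t∈QP , t⫫) =
      ｛ t ｝^⊥ , (t , t∈QP , λ π∈ → π∈ refl) , λ m →
      -- As `≤•` is reverse inclusion, what is left is `t ⊥ π` for every `π` in `φ m ⇒• ψ m`.
      proj₂ (adjunction {｛ t ｝^⊥} {φ m} {ψ m}) λ { π∈ refl → t⫫ m π∈ }

    ⊢ᴬ⇒⊢• : _⊢ᴬ_ oca φ ψ → φ ⊢• ψ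
    ⊢ᴬ⇒⊢• (r , (t , t∈QP , t⫫r) , rφ≤ψ) =
      t , t∈QP , λ m π∈ →
      -- The adjunction puts `φ m ⇒• ψ m` inside `r`, so one realiser of `r` serves all `m`.
      t⫫r (proj₁ (adjunction {r} {φ m} {ψ m}) (rφ≤ψ m) π∈)

  -- Both fibres have the same carrier and equality, and both reindex by precomposition; only the
  -- preorders differ, so identity maps suffice.
  𝐏•≅𝐏 : (i : Level) → 𝐏• i ≅ 𝐏 oca i
  𝐏•≅𝐏 i = record
    { to      = λ I → record
      { ⟦_⟧ = id
      ; isOrderHomomorphism = record
        { cong = id ; mono = λ {φ} {ψ} → ⊢•⇒⊢ᴬ φ ψ }
      }
    ; from    = λ I → record
      { ⟦_⟧ = id
      ; isOrderHomomorphism = record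
        { cong = id ; mono = λ {φ} {ψ} → ⊢ᴬ⇒⊢• φ ψ }
      }
    ; from∘to = λ I φ m → id , id
    ; to∘from = λ I φ m → id , id
    ; natural = λ f φ m → id , id
    }

mainTheorem16 : {ℓ : Level} (𝒦 : AbstractKrivineStructure ℓ) (i : Level) →
    let open Krivine 𝒦 in
    (Σ[ iso ∈ 𝐏• i ≅ 𝐏 (FullAdjunctionIOCA.oca 𝒜•) i ]
    ((I : Set i) (φ : I → 𝒫•) → _≅_.to⟦_⟧ iso I φ ≡ φ))
    ×
    ((I : Set i) (φ ψ : I → 𝒫•) →
    (∃[ t ] (t ∈ QP × (∀ m → t ⫫ ⌊ φ m ⇒• ψ m ⌋)))
    ⇔
    (∃[ r ] (r ∈ Φ × (∀ m → ⌊ r ∘• φ m ⌋ ⊇ ⌊ ψ m ⌋))))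
mainTheorem16 𝒦 i =
  (𝐏•≅𝐏 𝒦 i , λ I φ → refl) ,
  λ I φ ψ → mk⇔ (⊢•⇒⊢ᴬ 𝒦 φ ψ) (⊢ᴬ⇒⊢• 𝒦 φ ψ)
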